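{- $t(K(12,4))=2$. Moreover, if $S$ is a vertex cut of $K(12,4)$ such that $\frac{|S|}{c(K(12,4)\setminus S)} = 2$, then $S$ is the complement of a maximum independent set of $K(12,4)$.
   Context: The Kneser graph $K(n,k)$ has as vertices the $k$-element subsets of $[n]=\{1,\dots,n\}$, two vertices adjacent iff the subsets are disjoint. A vertex cut is a set $S$ of vertices whose removal disconnects the graph; $c(G\setminus S)$ is the number of connected components after deleting $S$; the toughness is $t(G)=\min_S |S|/c(G\setminus S)$ over all vertex cuts $S$. -}

module Defs where

open import Data.Bool using (Bool; true; false; not; _∧_)
open import Data.Nat using (ℕ; zero; suc; _*_; _≤_; _≟_)
open import Data.Fin using (Fin)
open import Data.Fin.Subset using (Subset; _∩_; ⊥; ∣_∣; inside; outside)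
open import Data.List using (List; []; _∷_; map; _++_; filter; length)
open import Data.Vec using (_∷_)
open import Data.Product using (Σ; ∃; _×_)
open import Relation.Nullary using (¬_)
open import Relation.Nullary.Decidable using (⌊_⌋)
open import Relation.Binary.PropositionalEquality using (_≡_)

allSubsets : (n : ℕ) → List (Subset n)
allSubsets zero = Data.Vec.[] ∷ []
allSubsets (suc n) = map (inside ∷_) (allSubsets n) ++ map (outside ∷_) (allSubsets n)

IsVertex : (n k : ℕ) → Subset n → Set
IsVertex n k A = ∣ A ∣ ≡ k

Adj : {n : ℕ} → Subset n → Subset n → Set
Adj A B = A ∩ B ≡ ⊥

-- A set of vertices of K(n,k) is given by a Boolean predicate on Subset n;
-- only its values on k-subsets matter.
VSet : ℕ → Set
VSet n = Subset n → Bool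

card : (n k : ℕ) → VSet n → ℕ
card n k S = length (filter (λ A → S A ∧ ⌊ ∣ A ∣ ≟ k ⌋ ≟b true) (allSubsets n))
  where
  open import Data.Bool.Properties using () renaming (_≟_ to _≟b_)

data Reach (n k : ℕ) (S : VSet n) (u : Subset n) : Subset n → Set where
  here : IsVertex n k u → S u ≡ false → Reach n k S u u
  step : ∀ {v w} → Reach n k S u v → IsVertex n k w → S w ≡ false →
         Adj v w → Reach n k S u w

HasComponents : (n k : ℕ) → VSet n → ℕ → Set
HasComponents n k S c =
  Σ (Fin c → Subset n) λ r →
    ((i : Fin c) → IsVertex n k (r i) × S (r i) ≡ false)
  × ((i j : Fin c) → Reach n k S (r i) (r j) → i ≡ j)
  × ((v : Subset n) → IsVertex n k v → S v ≡ false → ∃ λ i → Reach n k S (r i) v)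

IsCutWith : (n k : ℕ) → VSet n → ℕ → Set
IsCutWith n k S c = HasComponents n k S c × 2 ≤ c

-- Toughness equals t (a natural number), written out as a minimum over cuts:
-- every vertex cut S satisfies |S| / c(G∖S) ≥ t, and some cut attains t.
ToughnessIs : (n k : ℕ) → ℕ → Set
ToughnessIs n k t =
  (∀ S c → IsCutWith n k S c → t * c ≤ card n k S)
  × (∃ λ S → ∃ λ c → IsCutWith n k S c × card n k S ≡ t * c)

Independent : (n k : ℕ) → VSet n → Set
Independent n k I = ∀ A B → IsVertex n k A → IsVertex n k B →
  I A ≡ true → I B ≡ true → ¬ Adj A B

MaxIndependent : (n k : ℕ) → VSet n → Set
MaxIndependent n k I = Independent n k I ×
  (∀ J → Independent n k J → card n k J ≤ card n k I)

IsComplementOf : (n k : ℕ) → VSet n → VSet n → Set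
IsComplementOf n k S I = ∀ A → IsVertex n k A → S A ≡ not (I A)

{-# OPTIONS --safe #-}

-- In K(3k,k) every edge lies in exactly one triangle, so the D = C(2k,k) edges at a vertex
-- pair up into triangles. Let every B ∈ S give 2 to a triangle partner outside S whose other
-- partner is in S, and 1 to each of its two partners outside S otherwise. B then hands out at
-- most D in total, so the total charge on the surviving vertices is at most D |S|.
-- Pick one representative in each component; their closed neighbourhoods outside S are
-- pairwise disjoint. A vertex with d surviving neighbours has charge at least 2D − 3d, and if
-- d > 0 each of these neighbours has charge at least k + 1 ≥ 4, because its at least k + 1
-- common neighbours with another representative all lie in S. So each component accounts for
-- at least 2D + d, whence |S| ≥ 2c. Equality forces d = 0 for all representatives, so all
-- components are singletons; the survivors are then independent and number at least a third
-- of the vertices, which is the most that an independent set can have, since the complement of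
-- an independent set J is a cut with |J| components.
module Submission where

open import Defs
open import Data.Bool using (Bool; true; false; not; _∧_)
import Data.Bool.Properties as Bool
open import Data.Fin using (Fin; zero; suc)
import Data.Fin.Properties as Fin
open import Data.Fin.Subset using (Subset; _∪_; ∣_∣; inside; outside)
open import Data.Fin.Subset.Properties using (∣p∣≤n; ∣⊥∣≡0; ∩-comm; ∩-idem)
open import Data.List using (List; []; _∷_; filter; length; map; lookup)
import Data.List.Membership.Propositional.Properties as ∈
open import Data.List.Membership.Propositional using (_∈_)
open import Data.List.Properties using (length-++; filter-++)
import Data.List.Relation.Unary.All as All
import Data.List.Relation.Unary.AllPairs as AllPairs
open import Data.List.Relation.Unary.Any using (here; index)
import Data.List.Relation.Unary.Any.Properties as Any
open import Data.List.Relation.Unary.Unique.Propositional using (Unique)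
import Data.List.Relation.Unary.Unique.Propositional.Properties as Unique
open import Data.Nat using (ℕ; zero; suc; _+_; _*_; _∸_; _≤_; _<_; z≤n; s≤s; _≟_; >-nonZero)
open import Data.Nat.Combinatorics using (_C_; nCk≡nC[n∸k]; nCn≡1; nC1≡n; nCk+nC[k+1]≡[n+1]C[k+1])
open import Data.Nat.Properties hiding (_≟_)
open import Data.Nat.Tactic.RingSolver using (solve-∀)
open import Data.Product using (_×_; ∃; _,_; proj₁; proj₂)
open import Data.Sum using (_⊎_; inj₁; inj₂)
open import Data.Vec using ([]; _∷_; head)
open import Data.Vec.Properties using (≡-dec; ∷-injectiveʳ)
open import Function using (_∘_)
open import Relation.Binary.PropositionalEquality using (_≡_; _≢_; refl; sym; trans; cong; cong₂; subst)
open import Relation.Nullary using (¬_; Dec; yes; no; does; contradiction)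
open import Relation.Nullary.Decidable using (⌊_⌋)
open import Relation.Unary using (Decidable)

-- Sums over all subsets of the ground set.

𝟙 : Bool → ℕ
𝟙 true  = 1
𝟙 false = 0

-- The recursion splits on the first point exactly as `allSubsets` does, so cardinalities become
-- such sums and double counting becomes an exchange of sums.
∑ : ∀ {n} → (Subset n → ℕ) → ℕ
∑ {zero}  f = f []
∑ {suc n} f = ∑ (λ A → f (inside ∷ A)) + ∑ (λ A → f (outside ∷ A))

∑-cong : ∀ {n} {f g : Subset n → ℕ} → (∀ A → f A ≡ g A) → ∑ f ≡ ∑ g
∑-cong {zero}  f≗g = f≗g []
∑-cong {suc n} f≗g = cong₂ _+_ (∑-cong (λ A → f≗g (inside ∷ A))) (∑-cong (λ A → f≗g (outside ∷ A)))

∑-mono : ∀ {n} {f g : Subset n → ℕ} → (∀ A → f A ≤ g A) → ∑ f ≤ ∑ g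
∑-mono {zero}  f≤g = f≤g []
∑-mono {suc n} f≤g = +-mono-≤ (∑-mono (λ A → f≤g (inside ∷ A))) (∑-mono (λ A → f≤g (outside ∷ A)))

∑-distrib-+ : ∀ {n} (f g : Subset n → ℕ) → ∑ (λ A → f A + g A) ≡ ∑ f + ∑ g
∑-distrib-+ {zero}  f g = refl
∑-distrib-+ {suc n} f g
  rewrite ∑-distrib-+ (λ A → f (inside ∷ A)) (λ A → g (inside ∷ A))
        | ∑-distrib-+ (λ A → f (outside ∷ A)) (λ A → g (outside ∷ A))
  = +-interchange (∑ (λ A → f (inside ∷ A))) (∑ (λ A → g (inside ∷ A))) (∑ (λ A → f (outside ∷ A))) (∑ (λ A → g (outside ∷ A)))
  where
  +-interchange : ∀ a b c d → a + b + (c + d) ≡ a + c + (b + d)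
  +-interchange = solve-∀

*-distribˡ-∑ : ∀ {n} x (f : Subset n → ℕ) → ∑ (λ A → x * f A) ≡ x * ∑ f
*-distribˡ-∑ {zero}  x f = refl
*-distribˡ-∑ {suc n} x f
  rewrite *-distribˡ-∑ x (λ A → f (inside ∷ A)) | *-distribˡ-∑ x (λ A → f (outside ∷ A))
  = sym (*-distribˡ-+ x _ _)

*-distribʳ-∑ : ∀ {n} x (f : Subset n → ℕ) → ∑ (λ A → f A * x) ≡ ∑ f * x
*-distribʳ-∑ x f = trans (∑-cong (λ A → *-comm (f A) x)) (trans (*-distribˡ-∑ x f) (*-comm x (∑ f)))

∑-zero : ∀ n → ∑ {n} (λ _ → 0) ≡ 0
∑-zero n = *-distribˡ-∑ {n} 0 (λ _ → 0)

term≤∑ : ∀ {n} (f : Subset n → ℕ) A → f A ≤ ∑ f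
term≤∑ f []            = ≤-refl
term≤∑ f (inside ∷ A)  = ≤-trans (term≤∑ (f ∘ (inside ∷_)) A) (m≤m+n _ _)
term≤∑ f (outside ∷ A) = ≤-trans (term≤∑ (f ∘ (outside ∷_)) A) (m≤n+m _ _)

∑-comm : ∀ {m n} (f : Subset m → Subset n → ℕ) → ∑ (λ A → ∑ (λ B → f A B)) ≡ ∑ (λ B → ∑ (λ A → f A B))
∑-comm {zero}  f = refl
∑-comm {suc m} f
  rewrite ∑-comm (λ A → f (inside ∷ A)) | ∑-comm (λ A → f (outside ∷ A))
  = sym (∑-distrib-+ (λ B → ∑ (λ A → f (inside ∷ A) B)) _)

-- Sums over the components.

∑Fin : ∀ {c} → (Fin c → ℕ) → ℕ
∑Fin {zero}  t = 0
∑Fin {suc c} t = t zero + ∑Fin (t ∘ suc)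

∑Fin-mono : ∀ {c} {s t : Fin c → ℕ} → (∀ i → s i ≤ t i) → ∑Fin s ≤ ∑Fin t
∑Fin-mono {zero}  s≤t = z≤n
∑Fin-mono {suc c} s≤t = +-mono-≤ (s≤t zero) (∑Fin-mono (s≤t ∘ suc))

∑Fin-const+ : ∀ {c} x (t : Fin c → ℕ) → ∑Fin (λ i → x + t i) ≡ c * x + ∑Fin t
∑Fin-const+ {zero}  x t = refl
∑Fin-const+ {suc c} x t rewrite ∑Fin-const+ x (t ∘ suc) = rearrange x (t zero) (c * x) (∑Fin (t ∘ suc))
  where
  rearrange : ∀ a b d e → a + b + (d + e) ≡ a + d + (b + e)
  rearrange = solve-∀

*-distribʳ-∑Fin : ∀ {c} x (t : Fin c → ℕ) → ∑Fin (λ i → t i * x) ≡ ∑Fin t * x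
*-distribʳ-∑Fin {zero}  x t = refl
*-distribʳ-∑Fin {suc c} x t = trans (cong (t zero * x +_) (*-distribʳ-∑Fin x (t ∘ suc))) (sym (*-distribʳ-+ x (t zero) _))

term≤∑Fin : ∀ {c} (t : Fin c → ℕ) i → t i ≤ ∑Fin t
term≤∑Fin t zero    = m≤m+n (t zero) _
term≤∑Fin t (suc i) = ≤-trans (term≤∑Fin (t ∘ suc) i) (m≤n+m _ (t zero))

∑Fin-∑-comm : ∀ {c n} (f : Fin c → Subset n → ℕ) → ∑Fin (λ i → ∑ (f i)) ≡ ∑ (λ A → ∑Fin (λ i → f i A))
∑Fin-∑-comm {zero}  {n} f = sym (∑-zero n)
∑Fin-∑-comm {suc c} f =
  trans (cong (∑ (f zero) +_) (∑Fin-∑-comm (f ∘ suc))) (sym (∑-distrib-+ (f zero) _))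

∑Fin-zero : ∀ {c} {t : Fin c → ℕ} → (∀ i → t i ≡ 0) → ∑Fin t ≡ 0
∑Fin-zero {zero}  t≡0 = refl
∑Fin-zero {suc c} t≡0 rewrite t≡0 zero = ∑Fin-zero (t≡0 ∘ suc)

-- Once one term is nonzero, uniqueness makes all others vanish. This later says that a survivor
-- lies in at most one ball.
∑Fin≤1 : ∀ {c} {t : Fin c → ℕ} → (∀ i → t i ≤ 1) →
         (∀ i j → t i ≢ 0 → t j ≢ 0 → i ≡ j) → ∑Fin t ≤ 1
∑Fin≤1 {zero}  t≤1 unique = z≤n
∑Fin≤1 {suc c} {t} t≤1 unique with t zero ≟ 0
... | yes t₀≡0 rewrite t₀≡0 =
  ∑Fin≤1 (t≤1 ∘ suc) (λ i j tᵢ≢0 tⱼ≢0 → Fin.suc-injective (unique (suc i) (suc j) tᵢ≢0 tⱼ≢0))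
... | no t₀≢0 =
  ≤-trans (≤-reflexive (trans (cong (t zero +_) (∑Fin-zero others≡0)) (+-identityʳ (t zero)))) (t≤1 zero)
  where
  others≡0 : ∀ i → t (suc i) ≡ 0
  others≡0 i with t (suc i) ≟ 0
  ... | yes tᵢ≡0 = tᵢ≡0
  ... | no  tᵢ≢0 = contradiction (unique zero (suc i) t₀≢0 tᵢ≢0) λ ()

-- Decidable disjointness and sizes of unions.

disjoint : ∀ {n} → Subset n → Subset n → Bool
disjoint []      []      = true
disjoint (a ∷ A) (b ∷ B) = not (a ∧ b) ∧ disjoint A B

disjoint⇒Adj : ∀ {n} (A B : Subset n) → disjoint A B ≡ true → Adj A B
disjoint⇒Adj []            []            _ = refl
disjoint⇒Adj (inside ∷ A)  (outside ∷ B) d = cong (outside ∷_) (disjoint⇒Adj A B d)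
disjoint⇒Adj (outside ∷ A) (b ∷ B)       d = cong (outside ∷_) (disjoint⇒Adj A B d)

Adj⇒disjoint : ∀ {n} (A B : Subset n) → Adj A B → disjoint A B ≡ true
Adj⇒disjoint []            []            _ = refl
Adj⇒disjoint (inside ∷ A)  (outside ∷ B) d = Adj⇒disjoint A B (∷-injectiveʳ d)
Adj⇒disjoint (outside ∷ A) (b ∷ B)       d = Adj⇒disjoint A B (∷-injectiveʳ d)

Adj-sym : ∀ {n} {A B : Subset n} → Adj A B → Adj B A
Adj-sym {A = A} {B} d = trans (∩-comm B A) d

disjoint-comm : ∀ {n} (A B : Subset n) → disjoint A B ≡ disjoint B A
disjoint-comm []      []      = refl
disjoint-comm (a ∷ A) (b ∷ B) = cong₂ _∧_ (cong not (Bool.∧-comm a b)) (disjoint-comm A B)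

-- Reduces counting the common neighbours of two sets to counting the sets that avoid their union.
disjoint-∪ : ∀ {n} (A B X : Subset n) → 𝟙 (disjoint (A ∪ B) X) ≡ 𝟙 (disjoint A X) * 𝟙 (disjoint B X)
disjoint-∪ []            []            []            = refl
disjoint-∪ (inside ∷ A)  (b ∷ B)       (inside ∷ X)  = refl
disjoint-∪ (outside ∷ A) (inside ∷ B)  (inside ∷ X)  = sym (*-zeroʳ (𝟙 (disjoint A X)))
disjoint-∪ (outside ∷ A) (outside ∷ B) (inside ∷ X)  = disjoint-∪ A B X
disjoint-∪ (inside ∷ A)  (inside ∷ B)  (outside ∷ X) = disjoint-∪ A B X
disjoint-∪ (inside ∷ A)  (outside ∷ B) (outside ∷ X) = disjoint-∪ A B X
disjoint-∪ (outside ∷ A) (inside ∷ B)  (outside ∷ X) = disjoint-∪ A B X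
disjoint-∪ (outside ∷ A) (outside ∷ B) (outside ∷ X) = disjoint-∪ A B X

∣∪∣-disjoint : ∀ {n} (A B : Subset n) → disjoint A B ≡ true → ∣ A ∪ B ∣ ≡ ∣ A ∣ + ∣ B ∣
∣∪∣-disjoint []            []            _ = refl
∣∪∣-disjoint (inside ∷ A)  (outside ∷ B) d = cong suc (∣∪∣-disjoint A B d)
∣∪∣-disjoint (outside ∷ A) (inside ∷ B)  d = trans (cong suc (∣∪∣-disjoint A B d)) (sym (+-suc ∣ A ∣ ∣ B ∣))
∣∪∣-disjoint (outside ∷ A) (outside ∷ B) d = ∣∪∣-disjoint A B d

∣∪∣≤ : ∀ {n} (A B : Subset n) → ∣ A ∪ B ∣ ≤ ∣ A ∣ + ∣ B ∣
∣∪∣≤ []            []            = z≤n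
∣∪∣≤ (inside ∷ A)  (inside ∷ B)  = s≤s (≤-trans (∣∪∣≤ A B) (+-monoʳ-≤ ∣ A ∣ (n≤1+n ∣ B ∣)))
∣∪∣≤ (inside ∷ A)  (outside ∷ B) = s≤s (∣∪∣≤ A B)
∣∪∣≤ (outside ∷ A) (inside ∷ B)  = ≤-trans (s≤s (∣∪∣≤ A B)) (≤-reflexive (sym (+-suc ∣ A ∣ ∣ B ∣)))
∣∪∣≤ (outside ∷ A) (outside ∷ B) = ∣∪∣≤ A B

-- A common point is counted twice on the right. This one point is what leaves room for k + 1 points
-- outside two vertices that meet.
∣∪∣<-meeting : ∀ {n} (A B : Subset n) → disjoint A B ≡ false → ∣ A ∪ B ∣ < ∣ A ∣ + ∣ B ∣
∣∪∣<-meeting []            []            ()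
∣∪∣<-meeting (inside ∷ A)  (inside ∷ B)  _ = s≤s (≤-trans (s≤s (∣∪∣≤ A B)) (≤-reflexive (sym (+-suc ∣ A ∣ ∣ B ∣))))
∣∪∣<-meeting (inside ∷ A)  (outside ∷ B) d = s≤s (∣∪∣<-meeting A B d)
∣∪∣<-meeting (outside ∷ A) (inside ∷ B)  d = ≤-trans (s≤s (∣∪∣<-meeting A B d)) (≤-reflexive (sym (+-suc ∣ A ∣ ∣ B ∣)))
∣∪∣<-meeting (outside ∷ A) (outside ∷ B) d = ∣∪∣<-meeting A B d

-- Binomial coefficients.

nC0≡1 : ∀ n → n C 0 ≡ 1
nC0≡1 n = trans (nCk≡nC[n∸k] {n = n} z≤n) (nCn≡1 n)

[k+1]Ck≡k+1 : ∀ k → suc k C k ≡ suc k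
[k+1]Ck≡k+1 k = trans (nCk≡nC[n∸k] (n≤1+n k)) (trans (cong (suc k C_) (m+n∸n≡m 1 k)) (nC1≡n (suc k)))

C-monoˡ-suc : ∀ n k → n C k ≤ suc n C k
C-monoˡ-suc n zero    = ≤-reflexive (trans (nC0≡1 n) (sym (nC0≡1 (suc n))))
C-monoˡ-suc n (suc k) = ≤-trans (m≤n+m (n C suc k) (n C k)) (≤-reflexive (nCk+nC[k+1]≡[n+1]C[k+1] n k))

C-monoˡ : ∀ {m n} k → m ≤ n → m C k ≤ n C k
C-monoˡ {m} {n} k m≤n = subst (λ x → m C k ≤ x C k) (m∸n+n≡m m≤n) (grow (n ∸ m))
  where
  grow : ∀ d → m C k ≤ (d + m) C k
  grow zero    = ≤-refl
  grow (suc d) = ≤-trans (grow d) (C-monoˡ-suc (d + m) k)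

-- Counting vertices and edges by 0/1 indicators.

vertex : ∀ {n} → ℕ → Subset n → ℕ
vertex k A = 𝟙 (does (∣ A ∣ ≟ k))

-- The sets counted are the k-subsets of the complement of `A`. A point of `A` must be avoided; any
-- other point is taken or left, which is Pascal's rule.
count-disjoint : ∀ {n} k (A : Subset n) → ∑ (λ X → vertex k X * 𝟙 (disjoint A X)) ≡ (n ∸ ∣ A ∣) C k
count-disjoint zero    [] = refl
count-disjoint (suc k) [] = refl
count-disjoint {suc n} k (inside ∷ A) =
  cong₂ _+_ (trans (∑-cong {n} (λ X → *-zeroʳ (vertex k (inside ∷ X)))) (∑-zero n)) (count-disjoint k A)
count-disjoint {suc n} zero (outside ∷ A) =
  trans (cong₂ _+_ (∑-zero n) (count-disjoint zero A)) (trans (nC0≡1 (n ∸ ∣ A ∣)) (sym (nC0≡1 (suc n ∸ ∣ A ∣))))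
count-disjoint {suc n} (suc k) (outside ∷ A) =
  trans (cong₂ _+_ (count-disjoint k A) (count-disjoint (suc k) A))
  (trans (nCk+nC[k+1]≡[n+1]C[k+1] (n ∸ ∣ A ∣) k) (cong (_C suc k) (sym (+-∸-assoc 1 (∣p∣≤n A)))))

-- Matching on a value decides `P` and at the same time turns the numerical factor into the literal
-- 0 or 1, so products of indicators simplify by computation.
data Indicator (P : Set) : ℕ → Set where
  off : ¬ P → Indicator P 0
  on  : P → Indicator P 1

indicator : ∀ {P : Set} (P? : Dec P) → Indicator P (𝟙 (does P?))
indicator (yes p) = on p
indicator (no ¬p) = off ¬p

_×-indicator_ : ∀ {P Q : Set} {a b} → Indicator P a → Indicator Q b → Indicator (P × Q) (a * b)
off ¬p ×-indicator _      = off (¬p ∘ proj₁)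
on p   ×-indicator off ¬q = off (¬q ∘ proj₂)
on p   ×-indicator on q   = on (p , q)

Adj-indicator : ∀ {n} (A B : Subset n) → Indicator (Adj A B) (𝟙 (disjoint A B))
Adj-indicator A B with disjoint A B in d
... | true  = on (disjoint⇒Adj A B d)
... | false = off (λ a → contradiction (trans (sym (Adj⇒disjoint A B a)) d) λ ())

on≡1 : ∀ {P : Set} {a} → Indicator P a → P → a ≡ 1
on≡1 (off ¬p) p = contradiction p ¬p
on≡1 (on _)   _ = refl

vertex-indicator : ∀ {n} k (A : Subset n) → Indicator (IsVertex n k A) (vertex k A)
vertex-indicator k A = indicator (∣ A ∣ ≟ k)

Edge : ∀ {n} → ℕ → Subset n → Subset n → Set
Edge {n} k A B = IsVertex n k A × IsVertex n k B × Adj A B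

edge : ∀ {n} → ℕ → Subset n → Subset n → ℕ
edge k A B = vertex k A * (vertex k B * 𝟙 (disjoint A B))

edge-indicator : ∀ {n} k (A B : Subset n) → Indicator (Edge k A B) (edge k A B)
edge-indicator k A B = vertex-indicator k A ×-indicator (vertex-indicator k B ×-indicator Adj-indicator A B)

edge-comm : ∀ {n} k (A B : Subset n) → edge k A B ≡ edge k B A
edge-comm k A B rewrite disjoint-comm A B = swap (vertex k A) (vertex k B) (𝟙 (disjoint B A))
  where
  swap : ∀ a b d → a * (b * d) ≡ b * (a * d)
  swap = solve-∀

δ : ∀ {n} → Subset n → Subset n → ℕ
δ A B = 𝟙 (does (≡-dec Bool._≟_ A B))

δ-indicator : ∀ {n} (A B : Subset n) → Indicator (A ≡ B) (δ A B)
δ-indicator A B = indicator (≡-dec Bool._≟_ A B)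

∑-δ : ∀ {n} (A : Subset n) (f : Subset n → ℕ) → ∑ (λ X → δ A X * f X) ≡ f A
∑-δ []            f = +-identityʳ (f [])
∑-δ {suc n} (inside ∷ A)  f = trans (cong₂ _+_ (∑-δ A (f ∘ (inside ∷_))) (∑-zero n)) (+-identityʳ _)
∑-δ {suc n} (outside ∷ A) f = cong₂ _+_ (∑-zero n) (∑-δ A (f ∘ (outside ∷_)))

degree : ∀ {n} k (A : Subset n) → ∑ (edge k A) ≡ vertex k A * ((n ∸ k) C k)
degree {n} k A = trans (*-distribˡ-∑ {n} (vertex k A) _) (scaled (vertex-indicator k A))
  where
  scaled : ∀ {v} → Indicator (IsVertex n k A) v →
           v * ∑ (λ X → vertex k X * 𝟙 (disjoint A X)) ≡ v * ((n ∸ k) C k)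
  scaled (off _) = refl
  scaled (on vA) = cong (1 *_) (trans (count-disjoint k A) (cong (λ m → (n ∸ m) C k) vA))

common-neighbours : ∀ {n} k (A B : Subset n) → IsVertex n k A → IsVertex n k B →
                    ∑ (λ X → edge k A X * edge k B X) ≡ (n ∸ ∣ A ∪ B ∣) C k
common-neighbours {n} k A B vA vB = trans (∑-cong pointwise) (count-disjoint k (A ∪ B))
  where
  pointwise : ∀ X → edge k A X * edge k B X ≡ vertex k X * 𝟙 (disjoint (A ∪ B) X)
  pointwise X
    rewrite on≡1 (vertex-indicator k A) vA | on≡1 (vertex-indicator k B) vB | disjoint-∪ A B X
    with vertex k X | vertex-indicator k X
  ... | _ | off _ = refl
  ... | _ | on _  = rearrange (𝟙 (disjoint A X)) (𝟙 (disjoint B X))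
    where
    rearrange : ∀ a b → 1 * (1 * a) * (1 * (1 * b)) ≡ 1 * (a * b)
    rearrange = solve-∀

-- Cardinalities of vertex sets as sums.

length-filter-map : ∀ {X Y : Set} {P : Y → Set} (P? : Decidable P) (f : X → Y) xs →
                    length (filter P? (map f xs)) ≡ length (filter (P? ∘ f) xs)
length-filter-map P? f []       = refl
length-filter-map P? f (x ∷ xs) with does (P? (f x))
... | true  = cong suc (length-filter-map P? f xs)
... | false = length-filter-map P? f xs

length-filter-allSubsets : ∀ n {P : Subset n → Set} (P? : Decidable P) →
                           length (filter P? (allSubsets n)) ≡ ∑ (λ A → 𝟙 (does (P? A)))
length-filter-allSubsets zero P? with does (P? [])
... | true  = refl
... | false = refl
length-filter-allSubsets (suc n) P?
  rewrite filter-++ P? (map (inside ∷_) (allSubsets n)) (map (outside ∷_) (allSubsets n))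
        | length-++ (filter P? (map (inside ∷_) (allSubsets n))) {filter P? (map (outside ∷_) (allSubsets n))}
  = cong₂ _+_ (half inside) (half outside)
  where
  half : ∀ b → length (filter P? (map (b ∷_) (allSubsets n))) ≡ ∑ (λ A → 𝟙 (does (P? (b ∷ A))))
  half b = trans (length-filter-map P? (b ∷_) (allSubsets n)) (length-filter-allSubsets n (P? ∘ (b ∷_)))

card≡∑ : ∀ n k S → card n k S ≡ ∑ (λ A → vertex k A * 𝟙 (S A))
card≡∑ n k S = trans (length-filter-allSubsets n _) (∑-cong (λ A → pointwise (S A) (∣ A ∣ ≟ k)))
  where
  pointwise : ∀ b {P : Set} (P? : Dec P) → 𝟙 (does ((b ∧ ⌊ P? ⌋) Bool.≟ true)) ≡ 𝟙 (does P?) * 𝟙 b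
  pointwise true  (yes _) = refl
  pointwise true  (no _)  = refl
  pointwise false (yes _) = refl
  pointwise false (no _)  = refl

card+card-not : ∀ n k S → card n k S + card n k (not ∘ S) ≡ ∑ (vertex {n} k)
card+card-not n k S = trans (cong₂ _+_ (card≡∑ n k S) (card≡∑ n k (not ∘ S)))
  (trans (sym (∑-distrib-+ {n} (λ A → vertex k A * 𝟙 (S A)) _)) (∑-cong pointwise))
  where
  pointwise : ∀ A → vertex k A * 𝟙 (S A) + vertex k A * 𝟙 (not (S A)) ≡ vertex k A
  pointwise A with S A
  ... | true  = trans (cong₂ _+_ (*-identityʳ (vertex k A)) (*-zeroʳ (vertex k A))) (+-identityʳ (vertex k A))
  ... | false = cong₂ _+_ (*-zeroʳ (vertex k A)) (*-identityʳ (vertex k A))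

-- Triangles and common neighbours in K(3k,k).

module _ (k : ℕ) where

  private
    -- At k = 4 this computes to 12. `D` is the degree of every vertex.
    N = k + (k + k)
    D = (k + k) C k

  triangle : Subset N → Subset N → Subset N → ℕ
  triangle A B X = edge k A B * (edge k A X * edge k B X)

  triangle-swap₂₃ : ∀ A B X → triangle A B X ≡ triangle A X B
  triangle-swap₂₃ A B X rewrite edge-comm k B X = swap (edge k A B) (edge k A X) (edge k X B)
    where
    swap : ∀ a b c → a * (b * c) ≡ b * (a * c)
    swap = solve-∀

  triangle-swap₁₃ : ∀ A B X → triangle A B X ≡ triangle X B A
  triangle-swap₁₃ A B X
    rewrite edge-comm k A B | edge-comm k A X | edge-comm k B X = swap (edge k B A) (edge k X A) (edge k X B)
    where
    swap : ∀ a b c → a * (b * c) ≡ c * (b * a)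
    swap = solve-∀

  -- Two disjoint k-sets leave exactly k of the 3k points, and these form the only possible third
  -- vertex.
  ∑-triangle : ∀ A B → ∑ (triangle A B) ≡ edge k A B
  ∑-triangle A B = trans (*-distribˡ-∑ {N} (edge k A B) _) (unique-completion (edge-indicator k A B))
    where
    unique-completion : ∀ {e} → Indicator (Edge k A B) e → e * ∑ (λ X → edge k A X * edge k B X) ≡ e
    unique-completion (off _) = refl
    unique-completion (on (vA , vB , a)) = trans (+-identityʳ _) (trans (common-neighbours k A B vA vB)
      (trans (cong (λ m → (N ∸ m) C k) ∣A∪B∣≡k+k) (trans (cong (_C k) (m+n∸n≡m k (k + k))) (nCn≡1 k))))
      where
      ∣A∪B∣≡k+k : ∣ A ∪ B ∣ ≡ k + k
      ∣A∪B∣≡k+k = trans (∣∪∣-disjoint A B (Adj⇒disjoint A B a)) (cong₂ _+_ vA vB)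

  edge-degree : ∀ A → ∑ (edge k A) ≡ vertex k A * D
  edge-degree A = trans (degree k A) (cong (λ m → vertex k A * (m C k)) (m+n∸m≡n k (k + k)))

  -- Vertices that meet cover at most 2k - 1 points, so at least k + 1 points remain, and these have
  -- k + 1 subsets of size k.
  many-common-neighbours : ∀ {A B} → IsVertex N k A → IsVertex N k B → ¬ Adj A B →
                           suc k ≤ ∑ (λ X → edge k A X * edge k B X)
  many-common-neighbours {A} {B} vA vB ¬a = begin
    suc k                                  ≡⟨ [k+1]Ck≡k+1 k ⟨
    suc k C k                              ≤⟨ C-monoˡ k k+1≤N∸∣A∪B∣ ⟩
    (N ∸ ∣ A ∪ B ∣) C k                    ≡⟨ common-neighbours k A B vA vB ⟨
    ∑ (λ X → edge k A X * edge k B X)      ∎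
    where
    open ≤-Reasoning
    meets : disjoint A B ≡ false
    meets with disjoint A B in d
    ... | true  = contradiction (disjoint⇒Adj A B d) ¬a
    ... | false = refl
    ∣A∪B∣<k+k : ∣ A ∪ B ∣ < k + k
    ∣A∪B∣<k+k = subst (∣ A ∪ B ∣ <_) (cong₂ _+_ vA vB) (∣∪∣<-meeting A B meets)
    k+1≤N∸∣A∪B∣ : suc k ≤ N ∸ ∣ A ∪ B ∣
    k+1≤N∸∣A∪B∣ = m+n≤o⇒m≤o∸n (suc k) (≤-trans (≤-reflexive (sym (+-suc k ∣ A ∪ B ∣))) (+-monoʳ-≤ k ∣A∪B∣<k+k))

  -- Charge sent from removed vertices to survivors.

  module _ (S : VSet N) where

    private
      s χ : Subset N → ℕ
      s A = 𝟙 (S A)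
      χ A = 𝟙 (not (S A))

    survivingDegree : Subset N → ℕ
    survivingDegree A = ∑ (λ B → edge k A B * χ B)

    -- The pair (`B`, `X`) is ordered: `B` is the giver and `X` the third vertex, so each triangle
    -- at `A` is visited twice, once for each possible giver.
    charge : Subset N → ℕ
    charge A = ∑ (λ B → ∑ (λ X → triangle A B X * (s B * (1 + s X))))

    -- Since each edge has a unique completion, a weight that ignores the third vertex may be summed
    -- over edges instead.
    ∑∑-triangle : ∀ A (f : Subset N → ℕ) →
                  ∑ (λ B → ∑ (λ X → triangle A B X * f B)) ≡ ∑ (λ B → edge k A B * f B)
    ∑∑-triangle A f = ∑-cong (λ B → trans (*-distribʳ-∑ (f B) (triangle A B)) (cong (_* f B) (∑-triangle A B)))

    total-charge : ∑ (λ A → χ A * charge A) ≤ D * card N k S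
    total-charge = begin
      ∑ (λ A → χ A * charge A)
        ≡⟨ ∑-cong (λ A → sym (trans (∑-cong (λ B → *-distribˡ-∑ (χ A) (λ X → triangle A B X * (s B * (1 + s X))))) (*-distribˡ-∑ (χ A) (λ B → ∑ (λ X → triangle A B X * (s B * (1 + s X))))))) ⟩
      ∑ (λ A → ∑ (λ B → ∑ (λ X → χ A * (triangle A B X * (s B * (1 + s X))))))
        ≡⟨ ∑-comm (λ A B → ∑ (λ X → χ A * (triangle A B X * (s B * (1 + s X))))) ⟩
      ∑ (λ B → ∑ (λ A → ∑ (λ X → χ A * (triangle A B X * (s B * (1 + s X))))))
        -- The factor 1 + `s X` is split, and in the part carrying `s X` the receivers `A` and `X`
        -- trade names. Only then is each summand at most 1: before, a single ordered pair could
        -- carry 2.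
        ≡⟨ ∑-cong symmetrise ⟩
      ∑ (λ B → ∑ (λ A → ∑ (λ X → triangle A B X * (s B * (χ A + χ X * s A)))))
        ≤⟨ ∑-mono (λ B → ∑-mono (λ A → ∑-mono (λ X → *-monoʳ-≤ (triangle A B X) (*-monoʳ-≤ (s B) (at-most-one A X))))) ⟩
      ∑ (λ B → ∑ (λ A → ∑ (λ X → triangle A B X * (s B * 1))))
        -- A giver `B` lies in `D` ordered triangles, one for each edge at `B`.
        ≡⟨ ∑-cong collapse ⟩
      ∑ (λ B → D * (vertex k B * s B))
        ≡⟨ *-distribˡ-∑ D (λ B → vertex k B * s B) ⟩
      D * ∑ (λ B → vertex k B * s B)
        ≡⟨ cong (D *_) (card≡∑ N k S) ⟨
      D * card N k S ∎
      where
      open ≤-Reasoning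
      at-most-one : ∀ A X → χ A + χ X * s A ≤ 1
      at-most-one A X with S A | S X
      ... | true  | true  = z≤n
      ... | true  | false = ≤-refl
      ... | false | true  = ≤-refl
      ... | false | false = ≤-refl
      split : ∀ a t b x → a * (t * (b * (1 + x))) ≡ t * (b * a) + t * (b * (a * x))
      split = solve-∀
      merge : ∀ t a b c → t * (b * a) + t * (b * c) ≡ t * (b * (a + c))
      merge = solve-∀
      symmetrise : ∀ B → ∑ (λ A → ∑ (λ X → χ A * (triangle A B X * (s B * (1 + s X))))) ≡
                         ∑ (λ A → ∑ (λ X → triangle A B X * (s B * (χ A + χ X * s A))))
      symmetrise B = trans
        (trans (∑-cong (λ A → trans (∑-cong (λ X → split (χ A) (triangle A B X) (s B) (s X))) (∑-distrib-+ (λ X → triangle A B X * (s B * χ A)) _)))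
               (∑-distrib-+ (λ A → ∑ (λ X → triangle A B X * (s B * χ A))) _))
        (trans (cong (∑ (λ A → ∑ (λ X → triangle A B X * (s B * χ A))) +_)
                 (trans (∑-comm (λ A X → triangle A B X * (s B * (χ A * s X))))
                   (∑-cong (λ A → ∑-cong (λ X → cong (_* (s B * (χ X * s A))) (triangle-swap₁₃ X B A))))))
          (sym (trans (∑-cong (λ A → trans (∑-cong (λ X → sym (merge (triangle A B X) (χ A) (s B) (χ X * s A)))) (∑-distrib-+ (λ X → triangle A B X * (s B * χ A)) _)))
               (∑-distrib-+ (λ A → ∑ (λ X → triangle A B X * (s B * χ A))) _))))
      collapse : ∀ B → ∑ (λ A → ∑ (λ X → triangle A B X * (s B * 1))) ≡ D * (vertex k B * s B)
      collapse B = trans (∑-cong (λ A → trans (*-distribʳ-∑ (s B * 1) (triangle A B)) (cong (_* (s B * 1)) (trans (∑-triangle A B) (edge-comm k A B)))))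
        (trans (*-distribʳ-∑ (s B * 1) (edge k B)) (trans (cong (_* (s B * 1)) (edge-degree B)) (rearrange (vertex k B) D (s B))))
        where
        rearrange : ∀ v d b → v * d * (b * 1) ≡ d * (v * b)
        rearrange = solve-∀

    -- Each of the `D` ordered triangles at `A` should bring 2. What is missing is at most 2 if `B`
    -- survives, plus 1 if `X` does; as both range over the neighbours of `A`, the total shortfall
    -- is at most 2d + d, with d the surviving degree of `A`.
    charge-lower : ∀ A → IsVertex N k A → 2 * D ≤ charge A + 3 * survivingDegree A
    charge-lower A vA = begin
      2 * D
        ≡⟨ trans (*-comm 2 D) (sym (trans (∑-cong (λ B → *-distribʳ-∑ 2 (triangle A B))) (trans (*-distribʳ-∑ 2 (λ B → ∑ (triangle A B)))
             (cong (_* 2) (trans (∑-cong (∑-triangle A)) (trans (edge-degree A) (trans (cong (_* D) (on≡1 (vertex-indicator k A) vA)) (+-identityʳ D)))))))) ⟩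
      ∑ (λ B → ∑ (λ X → triangle A B X * 2))
        ≤⟨ ∑-mono (λ B → ∑-mono (λ X → *-monoʳ-≤ (triangle A B X) (at-least-two B X))) ⟩
      ∑ (λ B → ∑ (λ X → triangle A B X * (s B * (1 + s X) + (2 * χ B + χ X))))
        ≡⟨ ∑∑-distrib (λ B X → s B * (1 + s X)) (λ B X → 2 * χ B + χ X) ⟩
      charge A + ∑ (λ B → ∑ (λ X → triangle A B X * (2 * χ B + χ X)))
        ≡⟨ cong (charge A +_) (∑∑-distrib (λ B X → 2 * χ B) (λ B X → χ X)) ⟩
      charge A + (∑ (λ B → ∑ (λ X → triangle A B X * (2 * χ B))) + ∑ (λ B → ∑ (λ X → triangle A B X * χ X)))
        ≡⟨ cong (charge A +_) (cong₂ _+_ first second) ⟩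
      charge A + (2 * survivingDegree A + survivingDegree A)
        ≡⟨ cong (charge A +_) (+-comm (2 * survivingDegree A) _) ⟩
      charge A + 3 * survivingDegree A ∎
      where
      open ≤-Reasoning
      at-least-two : ∀ B X → 2 ≤ s B * (1 + s X) + (2 * χ B + χ X)
      at-least-two B X with S B | S X
      ... | true  | true  = ≤-refl
      ... | true  | false = ≤-refl
      ... | false | true  = ≤-refl
      ... | false | false = n≤1+n 2
      ∑∑-distrib : ∀ (f g : Subset N → Subset N → ℕ) →
        ∑ (λ B → ∑ (λ X → triangle A B X * (f B X + g B X))) ≡
        ∑ (λ B → ∑ (λ X → triangle A B X * f B X)) + ∑ (λ B → ∑ (λ X → triangle A B X * g B X))
      ∑∑-distrib f g = trans (∑-cong (λ B → trans (∑-cong (λ X → *-distribˡ-+ (triangle A B X) (f B X) (g B X)))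
        (∑-distrib-+ (λ X → triangle A B X * f B X) _))) (∑-distrib-+ (λ B → ∑ (λ X → triangle A B X * f B X)) _)
      swap : ∀ e x → e * (2 * x) ≡ 2 * (e * x)
      swap = solve-∀
      first : ∑ (λ B → ∑ (λ X → triangle A B X * (2 * χ B))) ≡ 2 * survivingDegree A
      first = trans (∑∑-triangle A (λ B → 2 * χ B)) (trans (∑-cong (λ B → swap (edge k A B) (χ B))) (*-distribˡ-∑ 2 (λ B → edge k A B * χ B)))
      second : ∑ (λ B → ∑ (λ X → triangle A B X * χ X)) ≡ survivingDegree A
      second = trans (∑-comm (λ B X → triangle A B X * χ X))
        (trans (∑-cong (λ X → ∑-cong (λ B → cong (_* χ X) (triangle-swap₂₃ A B X)))) (∑∑-triangle A χ))

    -- Representatives of components and their closed neighbourhoods.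

    module _ (3≤k : 3 ≤ k) {c} (2≤c : 2 ≤ c) (components : HasComponents N k S c) where

      private
        r : Fin c → Subset N
        r = proj₁ components

        r-vertex : ∀ i → IsVertex N k (r i)
        r-vertex i = proj₁ (proj₁ (proj₂ components) i)

        r-survives : ∀ i → S (r i) ≡ false
        r-survives i = proj₂ (proj₁ (proj₂ components) i)

        r-separated : ∀ i j → Reach N k S (r i) (r j) → i ≡ j
        r-separated = proj₁ (proj₂ (proj₂ components))

        r-covers : ∀ A → IsVertex N k A → S A ≡ false → ∃ λ i → Reach N k S (r i) A
        r-covers = proj₂ (proj₂ (proj₂ components))

        d : Fin c → ℕ
        d i = survivingDegree (r i)

        ball : Fin c → Subset N → ℕ
        ball i A = δ (r i) A + edge k (r i) A

      -- A self-adjacent set is empty, whereas k is positive. Hence the two terms of `ball` are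
      -- never both 1.
      ¬Edge-refl : ∀ {A : Subset N} → ¬ Edge k A A
      ¬Edge-refl {A} (vA , _ , a) = <⇒≢ (≤-trans (s≤s z≤n) 3≤k) (trans (sym (∣⊥∣≡0 N)) (trans (cong ∣_∣ (trans (sym a) (∩-idem A))) vA))

      ball≤1 : ∀ i A → ball i A ≤ 1
      ball≤1 i A with δ (r i) A | δ-indicator (r i) A | edge k (r i) A | edge-indicator k (r i) A
      ... | _ | off _    | _ | off _ = z≤n
      ... | _ | off _    | _ | on _  = ≤-refl
      ... | _ | on _     | _ | off _ = ≤-refl
      ... | _ | on r≡A   | _ | on e  = contradiction (subst (λ B → Edge k B A) r≡A e) ¬Edge-refl

      ball-cases : ∀ i A → ball i A ≢ 0 → r i ≡ A ⊎ Edge k (r i) A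
      ball-cases i A b≢0 with δ (r i) A | δ-indicator (r i) A | edge k (r i) A | edge-indicator k (r i) A
      ... | _ | on r≡A | _ | _     = inj₁ r≡A
      ... | _ | off _  | _ | on e  = inj₂ e
      ... | _ | off _  | _ | off _ = contradiction refl b≢0

      reach-self : ∀ i → Reach N k S (r i) (r i)
      reach-self i = here (r-vertex i) (r-survives i)

      -- A survivor in two balls would join their centres by a path of length at most 2.
      balls-disjoint : ∀ {A} → S A ≡ false → ∀ i j → ball i A ≢ 0 → ball j A ≢ 0 → i ≡ j
      balls-disjoint {A} A∉S i j bi bj = r-separated i j (arrive (ball-cases j A bj))
        where
        leave : r i ≡ A ⊎ Edge k (r i) A → Reach N k S (r i) A
        leave (inj₁ r≡A)          = subst (Reach N k S (r i)) r≡A (reach-self i)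
        leave (inj₂ (_ , vA , a)) = step (reach-self i) vA A∉S a
        arrive : r j ≡ A ⊎ Edge k (r j) A → Reach N k S (r i) (r j)
        arrive (inj₁ r≡A)         = subst (Reach N k S (r i)) (sym r≡A) (leave (ball-cases i A bi))
        arrive (inj₂ (_ , _ , a)) = step (leave (ball-cases i A bi)) (r-vertex j) (r-survives j) (Adj-sym a)

      -- The factor `χ A` restricts the weight to survivors, and no survivor is counted by two
      -- balls.
      packing : ∀ (f : Subset N → ℕ) → ∑Fin (λ i → ∑ (λ A → ball i A * (χ A * f A))) ≤ ∑ (λ A → χ A * f A)
      packing f = ≤-trans (≤-reflexive (∑Fin-∑-comm (λ i A → ball i A * (χ A * f A)))) (∑-mono pointwise)
        where
        pointwise : ∀ A → ∑Fin (λ i → ball i A * (χ A * f A)) ≤ χ A * f A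
        pointwise A with S A in eq
        ... | true  = ≤-reflexive (∑Fin-zero (λ i → *-zeroʳ (ball i A)))
        ... | false = ≤-trans (≤-reflexive (*-distribʳ-∑Fin (1 * f A) (λ i → ball i A)))
                        (≤-trans (*-monoˡ-≤ (1 * f A) (∑Fin≤1 (λ i → ball≤1 i A) (balls-disjoint eq))) (≤-reflexive (*-identityˡ (1 * f A))))

      ∑-ball : ∀ i (f : Subset N → ℕ) → ∑ (λ A → ball i A * (χ A * f A)) ≡ f (r i) + ∑ (λ A → edge k (r i) A * (χ A * f A))
      ∑-ball i f = trans (∑-cong (λ A → *-distribʳ-+ (χ A * f A) (δ (r i) A) (edge k (r i) A)))
        (trans (∑-distrib-+ (λ A → δ (r i) A * (χ A * f A)) _)
          (cong (_+ ∑ (λ A → edge k (r i) A * (χ A * f A))) (trans (∑-δ (r i) (λ A → χ A * f A))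
            (trans (cong (λ b → 𝟙 (not b) * f (r i)) (r-survives i)) (*-identityˡ (f (r i)))))))

      another : ∀ {c} → 2 ≤ c → (i : Fin c) → ∃ λ j → i ≢ j
      another (s≤s (s≤s _)) zero    = suc zero , λ ()
      another (s≤s (s≤s _)) (suc i) = zero , λ ()

      -- All common neighbours of A and a representative of another component lie in S.
      charge-neighbour : ∀ i A → Edge k (r i) A → S A ≡ false → suc k ≤ charge A
      charge-neighbour i A (_ , vA , a) A∉S = begin
        suc k
          -- `A` lies in the component of `r i`, so it cannot be adjacent to `r j`; the two vertices
          -- therefore meet.
          ≤⟨ many-common-neighbours vA (r-vertex j) (λ a′ → i≢j (r-separated i j (step reach-A (r-vertex j) (r-survives j) a′))) ⟩
        ∑ (λ B → edge k A B * edge k (r j) B)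
          ≤⟨ ∑-mono common⇒removed ⟩
        ∑ (λ B → edge k A B * s B)
          ≡⟨ ∑∑-triangle A s ⟨
        ∑ (λ B → ∑ (λ X → triangle A B X * s B))
          ≤⟨ ∑-mono (λ B → ∑-mono (λ X → *-monoʳ-≤ (triangle A B X) (m≤m*n (s B) (1 + s X)))) ⟩
        charge A ∎
        where
        open ≤-Reasoning
        j : Fin c
        j = proj₁ (another 2≤c i)
        i≢j : i ≢ j
        i≢j = proj₂ (another 2≤c i)
        reach-A : Reach N k S (r i) A
        reach-A = step (reach-self i) vA A∉S a
        common⇒removed : ∀ B → edge k A B * edge k (r j) B ≤ edge k A B * s B
        common⇒removed B with edge k A B | edge-indicator k A B | edge k (r j) B | edge-indicator k (r j) B
        ... | _ | off _ | _ | _     = z≤n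
        ... | _ | on _  | _ | off _ = z≤n
        ... | _ | on (_ , vB , aB) | _ | on (_ , _ , a′) with S B in eq
        ...   | true  = ≤-refl
        -- A surviving common neighbour would continue the path from `r i` through `A` to `r j`.
        ...   | false = contradiction (r-separated i j (step (step reach-A vB eq aB) (r-vertex j) (r-survives j) (Adj-sym a′))) i≢j

      -- The 3 d units that charge-lower loses at the representative are repaid by its d
      -- surviving neighbours, each carrying at least k + 1 ≥ 4.
      ball-charge : ∀ i → 2 * D + d i ≤ ∑ (λ A → ball i A * (χ A * charge A))
      ball-charge i = begin
        2 * D + d i
          ≤⟨ +-monoˡ-≤ (d i) (charge-lower (r i) (r-vertex i)) ⟩
        charge (r i) + 3 * d i + d i
          ≡⟨ rearrange (charge (r i)) (d i) ⟩
        charge (r i) + d i * 4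
          ≡⟨ cong (charge (r i) +_) (*-distribʳ-∑ 4 (λ A → edge k (r i) A * χ A)) ⟨
        charge (r i) + ∑ (λ A → edge k (r i) A * χ A * 4)
          ≤⟨ +-monoʳ-≤ (charge (r i)) (∑-mono pointwise) ⟩
        charge (r i) + ∑ (λ A → edge k (r i) A * (χ A * charge A))
          ≡⟨ ∑-ball i charge ⟨
        ∑ (λ A → ball i A * (χ A * charge A)) ∎
        where
        open ≤-Reasoning
        rearrange : ∀ x y → x + 3 * y + y ≡ x + y * 4
        rearrange = solve-∀
        bound : ∀ A b → S A ≡ b → Edge k (r i) A → 𝟙 (not b) * 4 ≤ 𝟙 (not b) * charge A
        bound A true  _  _ = z≤n
        bound A false eq e = *-monoʳ-≤ 1 (≤-trans (s≤s 3≤k) (charge-neighbour i A e eq))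
        pointwise : ∀ A → edge k (r i) A * χ A * 4 ≤ edge k (r i) A * (χ A * charge A)
        pointwise A = ≤-trans (≤-reflexive (*-assoc (edge k (r i) A) (χ A) 4)) (scaled (edge-indicator k (r i) A))
          where
          scaled : ∀ {e} → Indicator (Edge k (r i) A) e → e * (χ A * 4) ≤ e * (χ A * charge A)
          scaled (off _) = z≤n
          scaled (on e)  = *-monoʳ-≤ 1 (bound A (S A) refl e)

      -- Bounds on the cut and on the number of components.

      charge-balance : D * (2 * c) + ∑Fin d ≤ D * card N k S
      charge-balance = begin
        -- The surplus `∑Fin d` is carried along because the equality case depends on it.
        D * (2 * c) + ∑Fin d    ≡⟨ cong (_+ ∑Fin d) (rearrange D c) ⟩
        c * (2 * D) + ∑Fin d    ≡⟨ ∑Fin-const+ (2 * D) d ⟨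
        ∑Fin (λ i → 2 * D + d i) ≤⟨ ∑Fin-mono ball-charge ⟩
        ∑Fin (λ i → ∑ (λ A → ball i A * (χ A * charge A))) ≤⟨ packing charge ⟩
        ∑ (λ A → χ A * charge A) ≤⟨ total-charge ⟩
        D * card N k S ∎
        where
        open ≤-Reasoning
        rearrange : ∀ x y → x * (2 * y) ≡ y * (2 * x)
        rearrange = solve-∀

      0<D : 0 < D
      0<D = ≤-trans (s≤s z≤n) (≤-trans (≤-reflexive (sym ([k+1]Ck≡k+1 k))) (C-monoˡ k (+-monoˡ-≤ k (≤-trans (s≤s z≤n) 3≤k))))

      cut-lower-bound : 2 * c ≤ card N k S
      cut-lower-bound = *-cancelˡ-≤ D {{>-nonZero 0<D}} (≤-trans (m≤m+n (D * (2 * c)) (∑Fin d)) charge-balance)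

      -- Each representative contributes 1 to its own ball, and the balls share no survivor.
      components≤survivors : c ≤ card N k (not ∘ S)
      components≤survivors = begin
        c                                     ≡⟨ trans (+-identityʳ (c * 1)) (*-identityʳ c) ⟨
        c * 1 + 0                             ≡⟨ cong (c * 1 +_) (∑Fin-zero {c} (λ _ → refl)) ⟨
        c * 1 + ∑Fin {c} (λ _ → 0)            ≡⟨ ∑Fin-const+ {c} 1 (λ _ → 0) ⟨
        ∑Fin {c} (λ _ → 1)                    ≤⟨ ∑Fin-mono one-each ⟩
        ∑Fin (λ i → ∑ (λ A → ball i A * (χ A * vertex k A))) ≤⟨ packing (vertex k) ⟩
        ∑ (λ A → χ A * vertex k A)            ≡⟨ ∑-cong (λ A → *-comm (χ A) (vertex k A)) ⟩
        ∑ (λ A → vertex k A * χ A)            ≡⟨ card≡∑ N k (not ∘ S) ⟨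
        card N k (not ∘ S) ∎
        where
        open ≤-Reasoning
        one-each : ∀ i → 1 ≤ ∑ (λ A → ball i A * (χ A * vertex k A))
        one-each i = ≤-trans (≤-reflexive (sym (on≡1 (vertex-indicator k (r i)) (r-vertex i))))
          (≤-trans (m≤m+n (vertex k (r i)) _) (≤-reflexive (sym (∑-ball i (vertex k)))))

      -- The equality case.

      module _ (tight : card N k S ≡ 2 * c) where

        -- With equality, D · 2c cancels from both sides of `charge-balance` and nothing is left for
        -- the surplus.
        d≡0 : ∀ i → d i ≡ 0
        d≡0 i = n≤0⇒n≡0 (≤-trans (term≤∑Fin d i) (+-cancelˡ-≤ (D * (2 * c)) (∑Fin d) 0
          (≤-trans charge-balance (≤-reflexive (trans (cong (D *_) tight) (sym (+-identityʳ (D * (2 * c)))))))))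

        isolated : ∀ i A → Edge k (r i) A → S A ≢ false
        isolated i A e A∉S = contradiction (trans (sym edge*χ≡1) (n≤0⇒n≡0 (≤-trans (term≤∑ (λ B → edge k (r i) B * χ B) A) (≤-reflexive (d≡0 i))))) λ ()
          where
          edge*χ≡1 : edge k (r i) A * χ A ≡ 1
          edge*χ≡1 = cong₂ _*_ (on≡1 (edge-indicator k (r i) A) e) (cong (𝟙 ∘ not) A∉S)

        -- By induction the path is still at `r i` before its last step, and that step would reach a
        -- surviving neighbour of `r i`.
        singleton : ∀ i {A} → Reach N k S (r i) A → r i ≡ A
        singleton i (here _ _) = refl
        singleton i (step {v} {w} p vw w∉S a) with singleton i p
        ... | refl = contradiction w∉S (isolated i w (r-vertex i , vw , a))

        survivors-independent : Independent N k (not ∘ S)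
        survivors-independent A B vA vB IA IB a with r-covers A vA (Bool.not-injective IA)
        ... | i , p with singleton i p
        ... | refl = isolated i B (vA , vB , a) (Bool.not-injective IB)

-- Independent sets as survivors of cuts.

allSubsets-complete : ∀ {n} (A : Subset n) → A ∈ allSubsets n
allSubsets-complete []            = here refl
allSubsets-complete (inside ∷ A)  = ∈.∈-++⁺ˡ (∈.∈-map⁺ (inside ∷_) (allSubsets-complete A))
allSubsets-complete {suc n} (outside ∷ A) =
  ∈.∈-++⁺ʳ (map (inside ∷_) (allSubsets n)) (∈.∈-map⁺ (outside ∷_) (allSubsets-complete A))

allSubsets-unique : ∀ n → Unique (allSubsets n)
allSubsets-unique zero    = All.[] AllPairs.∷ AllPairs.[]
allSubsets-unique (suc n) =
  Unique.++⁺ (Unique.map⁺ ∷-injectiveʳ (allSubsets-unique n)) (Unique.map⁺ ∷-injectiveʳ (allSubsets-unique n)) heads-differ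
  where
  heads-differ : ∀ {A} → ¬ (A ∈ map (inside ∷_) (allSubsets n) × A ∈ map (outside ∷_) (allSubsets n))
  heads-differ (A∈in , A∈out) with ∈.∈-map⁻ (inside ∷_) A∈in | ∈.∈-map⁻ (outside ∷_) A∈out
  ... | _ , _ , refl | _ , _ , ()

lookup-injective : ∀ {A : Set} {xs : List A} → Unique xs → ∀ i j → lookup xs i ≡ lookup xs j → i ≡ j
lookup-injective {xs = x ∷ xs} (_ AllPairs.∷ _)  zero    zero    _  = refl
lookup-injective {xs = x ∷ xs} (x∉ AllPairs.∷ _) zero    (suc j) eq = contradiction eq (All.lookup x∉ (∈.∈-lookup j))
lookup-injective {xs = x ∷ xs} (x∉ AllPairs.∷ _) (suc i) zero    eq = contradiction (sym eq) (All.lookup x∉ (∈.∈-lookup i))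
lookup-injective {xs = x ∷ xs} (_ AllPairs.∷ u)  (suc i) (suc j) eq = cong suc (lookup-injective u i j eq)

-- No edge survives, so every member of `J` is a component by itself. The representatives are the
-- entries of the very list whose length defines `card n k J`; it has no repetitions, so they are
-- distinct.
independent-components : ∀ n k J → Independent n k J → HasComponents n k (not ∘ J) (card n k J)
independent-components n k J indep = lookup members , members-survive , separated , covers
  where
  member? : ∀ A → Dec (J A ∧ ⌊ ∣ A ∣ ≟ k ⌋ ≡ true)
  member? A = J A ∧ ⌊ ∣ A ∣ ≟ k ⌋ Bool.≟ true
  members : List (Subset n)
  members = filter member? (allSubsets n)
  split : ∀ {a P} (P? : Dec P) → a ∧ ⌊ P? ⌋ ≡ true → P × not a ≡ false
  split {true} (yes p) _ = p , refl
  join : ∀ {a P} (P? : Dec P) → P → not a ≡ false → a ∧ ⌊ P? ⌋ ≡ true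
  join {true} (yes _) _ _ = refl
  join {true} (no ¬p) p _ = contradiction p ¬p
  members-survive : ∀ i → IsVertex n k (lookup members i) × not (J (lookup members i)) ≡ false
  members-survive i = split (∣ lookup members i ∣ ≟ k) (proj₂ (∈.∈-filter⁻ member? {xs = allSubsets n} (∈.∈-lookup i)))
  stationary : ∀ {A B} → Reach n k (not ∘ J) A B → IsVertex n k B × not (J B) ≡ false × A ≡ B
  stationary (here vA A∉S) = vA , A∉S , refl
  stationary (step p vB B∉S a) with stationary p
  ... | vA , A∉S , refl = contradiction a (indep _ _ vA vB (Bool.not-injective A∉S) (Bool.not-injective B∉S))
  separated : ∀ i j → Reach n k (not ∘ J) (lookup members i) (lookup members j) → i ≡ j
  separated i j p = lookup-injective (Unique.filter⁺ member? (allSubsets-unique n)) i j (proj₂ (proj₂ (stationary p)))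
  covers : ∀ A → IsVertex n k A → not (J A) ≡ false → ∃ λ i → Reach n k (not ∘ J) (lookup members i) A
  covers A vA A∉S = index A∈ , subst (λ B → Reach n k (not ∘ J) B A) (Any.lookup-index A∈) (here vA A∉S)
    where
    A∈ : A ∈ members
    A∈ = ∈.∈-filter⁺ member? (allSubsets-complete A) (join (∣ A ∣ ≟ k) vA A∉S)

-- Here `head` is the star of the first point: it selects the sets containing that point, which all
-- meet there.
head-independent : ∀ n k → Independent (suc n) k head
head-independent n k (inside ∷ A) (inside ∷ B) _ _ _ _ ()

-- Both `J` and the survivors `I` are compared with the number of all vertices, which is at least
-- 3|J| by the cut bound and at most 3|I| by tightness.
tight-cut⇒maximum : ∀ {k} → 3 ≤ k → ∀ S c → IsCutWith (k + (k + k)) k S c → card (k + (k + k)) k S ≡ 2 * c →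
                    MaxIndependent (k + (k + k)) k (not ∘ S)
tight-cut⇒maximum {k} 3≤k S c (components , 2≤c) tight = survivors-independent k S 3≤k 2≤c components tight , maximum
  where
  N = k + (k + k)
  I = not ∘ S
  c≤∣I∣ : c ≤ card N k I
  c≤∣I∣ = components≤survivors k S 3≤k 2≤c components
  maximum : ∀ J → Independent N k J → card N k J ≤ card N k I
  maximum J indep with ≤-<-connex (card N k J) 1
  -- With at most one member of `J`, its complement leaves fewer than two components and the cut
  -- bound does not apply; but `I` has at least two members.
  ... | inj₁ small = ≤-trans small (≤-trans (n≤1+n 1) (≤-trans 2≤c c≤∣I∣))
  ... | inj₂ 2≤∣J∣ = *-cancelˡ-≤ 3 (begin
    3 * card N k J                        ≡⟨⟩
    card N k J + 2 * card N k J           ≤⟨ +-monoʳ-≤ (card N k J) (cut-lower-bound k (not ∘ J) 3≤k 2≤∣J∣ (independent-components N k J indep)) ⟩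
    card N k J + card N k (not ∘ J)       ≡⟨ trans (card+card-not N k J) (sym (card+card-not N k S)) ⟩
    card N k S + card N k I               ≡⟨ cong (_+ card N k I) tight ⟩
    2 * c + card N k I                    ≤⟨ +-monoˡ-≤ (card N k I) (*-monoʳ-≤ 2 c≤∣I∣) ⟩
    2 * card N k I + card N k I           ≡⟨ +-comm (2 * card N k I) (card N k I) ⟩
    3 * card N k I ∎)
    where open ≤-Reasoning

theorem24 : ToughnessIs 12 4 2
    × (∀ S c → IsCutWith 12 4 S c → card 12 4 S ≡ 2 * c →
    ∃ λ I → MaxIndependent 12 4 I × IsComplementOf 12 4 S I)
theorem24 = (lower , attained) , equality
  where
  3≤4 : 3 ≤ 4
  3≤4 = n≤1+n 3
  lower : ∀ S c → IsCutWith 12 4 S c → 2 * c ≤ card 12 4 S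
  lower S c (components , 2≤c) = cut-lower-bound 4 S 3≤4 2≤c components
  attained : ∃ λ S → ∃ λ c → IsCutWith 12 4 S c × card 12 4 S ≡ 2 * c
  -- The star has C(11,3) = 165 members and its complement C(11,4) = 330; both numerical conditions
  -- are checked by evaluation.
  attained = not ∘ head , card 12 4 head
    , (independent-components 12 4 head (head-independent 11 4) , ≤ᵇ⇒≤ 2 (card 12 4 head) _) , refl
  equality : ∀ S c → IsCutWith 12 4 S c → card 12 4 S ≡ 2 * c →
             ∃ λ I → MaxIndependent 12 4 I × IsComplementOf 12 4 S I
  equality S c cut tight = not ∘ S , tight-cut⇒maximum 3≤4 S c cut tight , λ A _ → sym (Bool.not-involutive (S A))
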